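{- Let $p$ be a prime, $q=p^f$ with $f\ge1$, let $k\mid q-1$, and let $A_k=\{x^k:x\in\mathbb{F}_q^\times\}\le\mathbb{F}_q^\times$ have order $t=(q-1)/k>4$. If $p^e\equiv-1\pmod t$ for some integer $e\ge1$, then $$|(A_k-a)\cap(A_k-b)|\le2\qquad(a,b\in\mathbb{F}_q,\ a\neq b).$$ In particular, $A_k$ is additively irreducible.
   Context: $A-a=\{x-a:x\in A\}$. A set $A\subseteq\mathbb{F}_q$ is additively irreducible if there are no sets $S,T\subseteq\mathbb{F}_q$ with $|S|,|T|\ge2$ and $A=S+T$, where $S+T=\{s+u:s\in S,\ u\in T\}$. -}

module Defs where

open import Algebra.Bundles using (CommutativeRing)
import Algebra.Definitions as AlgebraDefinitions
import Algebra.Properties.Semiring.Exp as Exp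
open import Data.Fin.Base using (Fin)
open import Data.Nat.Base using (ℕ; _≤_; _≥_)
open import Data.Product.Base using (_×_; ∃; ∃₂; proj₁)
open import Function.Bundles using (Bijection)
open import Level using (Level; _⊔_; suc)
open import Relation.Binary.Bundles using (Setoid)
import Relation.Binary.Construct.On as On
open import Relation.Binary.PropositionalEquality.Properties using (setoid)
open import Relation.Nullary.Negation.Core using (¬_)
open import Relation.Unary using (Pred; _∈_; _≐_)

-- Discrete fields (inverses of all x ≉ 0#), not Heyting fields: equality on
-- a finite setoid is decidable, so no separate apartness relation is needed.
record Field (c ℓ : Level) : Set (suc (c ⊔ ℓ)) where
  field
    commutativeRing : CommutativeRing c ℓ

  open CommutativeRing commutativeRing public
  open AlgebraDefinitions _≈_ public using (Invertible)

  field
    1≉0        : ¬ (1# ≈ 0#)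
    invertible : ∀ x → ¬ (x ≈ 0#) → Invertible 1# _*_ x

infix 4 _HasCardinality_

_HasCardinality_ : ∀ {c ℓ} → Setoid c ℓ → ℕ → Set (c ⊔ ℓ)
X HasCardinality n = Bijection X (setoid (Fin n))

module Subsets {c ℓ} (F : Field c ℓ) where

  open Field F renaming (setoid to F-setoid)
  open Exp semiring using (_^_)

  -- Elements of a subset are compared by ≈ of the field alone, ignoring the
  -- membership proofs.
  subsetoid : ∀ {s} → Pred Carrier s → Setoid (c ⊔ s) ℓ
  subsetoid S = On.setoid F-setoid (proj₁ {B = S})

  infix 4 ∣_∣≤_ ∣_∣≥_

  ∣_∣≤_ : ∀ {s} → Pred Carrier s → ℕ → Set (c ⊔ ℓ ⊔ s)
  ∣ S ∣≤ n = ∃ λ m → subsetoid S HasCardinality m × m ≤ n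

  ∣_∣≥_ : ∀ {s} → Pred Carrier s → ℕ → Set (c ⊔ ℓ ⊔ s)
  ∣ S ∣≥ n = ∃ λ m → subsetoid S HasCardinality m × m ≥ n

  infixl 8 _⊖_ _⊕_

  _⊖_ : ∀ {s} → Pred Carrier s → Carrier → Pred Carrier (c ⊔ ℓ ⊔ s)
  (A ⊖ a) y = ∃ λ x → x ∈ A × y ≈ x - a

  _⊕_ : ∀ {s t} → Pred Carrier s → Pred Carrier t → Pred Carrier (c ⊔ ℓ ⊔ s ⊔ t)
  (S ⊕ T) y = ∃₂ λ s u → s ∈ S × u ∈ T × y ≈ s + u

  Powers : ℕ → Pred Carrier (c ⊔ ℓ)
  Powers k y = ∃ λ x → ¬ (x ≈ 0#) × y ≈ x ^ k

  AdditivelyIrreducible : Pred Carrier (c ⊔ ℓ) → Set (suc (c ⊔ ℓ))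
  AdditivelyIrreducible A =
    ¬ (∃₂ λ (S T : Pred Carrier (c ⊔ ℓ)) → ∣ S ∣≥ 2 × ∣ T ∣≥ 2 × A ≐ S ⊕ T)

-- Let N = pᵉ. Elements of A = A_k satisfy uᵗ = 1, hence u·uᴺ = 1 because t divides N + 1,
-- while x ↦ xᴺ is additive. If v and v + d lie in A with d ≠ 0, expanding
-- 1 = (v + d)(vᴺ + dᴺ) and using v·vᴺ = 1 shows that v is a root of the monic
-- quadratic v² + dv + d/dᴺ, so there are at most two such v. If A = S + T with
-- |S|, |T| ≥ 2, then S lies in the intersection of two distinct shifts of A, and so does T;
-- hence |A| ≤ |S||T| ≤ 4. But A has at least t > 4 elements, since each
-- equation xᵏ = c has at most k solutions among the q - 1 = kt nonzero elements.
module Submission where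

open import Algebra.Bundles using (CommutativeMonoid)
import Algebra.Properties.CommutativeMonoid.Sum as CommutativeMonoidSum
import Algebra.Properties.CommutativeSemiring.Binomial as Binomial
import Algebra.Properties.Group as GroupProperties
import Algebra.Properties.Ring as RingProperties
import Algebra.Properties.Semiring.Exp as Exp
import Algebra.Properties.Semiring.Mult as Mult
import Algebra.Solver.Ring.NaturalCoefficients.Default as SemiringSolver
open import Data.Fin.Base as Fin using (Fin; fromℕ; inject₁; punchIn; punchOut)
open import Data.Fin.Permutation using (Permutation′; permutation)
import Data.Fin.Properties as Fin
open import Data.List.Base using
  (List; []; _∷_; cartesianProductWith; filter; length; lookup; map; tabulate)
import Data.List.Membership.Setoid as Membership
open import Data.List.Membership.Setoid.Properties
open import Data.List.Properties using (length-++; length-map; length-tabulate)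
open import Data.List.Relation.Unary.All as All using (All; []; _∷_)
import Data.List.Relation.Unary.All.Properties as All
open import Data.List.Relation.Unary.AllPairs using ([]; _∷_)
open import Data.List.Relation.Unary.Any as Any using (Any; here; there; index)
import Data.List.Relation.Unary.Any.Properties as Any
import Data.List.Relation.Unary.Unique.Setoid as Unique
import Data.List.Relation.Unary.Unique.Setoid.Properties as Uniqueₚ
import Data.Nat.Base as ℕ
open import Data.Nat.Base using
  (ℕ; zero; suc; NonZero; _∸_; _/_; _!; _≤_; _<_; _≥_; _>_; z≤n; s≤s)
open import Data.Nat.Combinatorics using (_C_; k![n∸k]!∣n!; nCk≡nC[n∸k]; nCn≡1)
open import Data.Nat.Combinatorics.Specification using (nCk≡n!/k![n-k]!)
open import Data.Nat.Divisibility using (_∣_; divides; m∣m*n; ∣1⇒≡1; ∣⇒≤)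
open import Data.Nat.DivMod using (m/n*n≡m)
open import Data.Nat.Primality using (Prime; euclidsLemma; ¬prime[1])
import Data.Nat.Properties as ℕ
open import Data.Product.Base using (_×_; _,_; proj₁; proj₂; ∃; ∃₂)
open import Data.Sum.Base using (inj₁; inj₂)
open import Data.Vec.Base as Vec using (Vec; []; _∷_)
open import Function.Base using (_∘_)
open import Function.Bundles using (Bijection)
open import Function.Definitions using (Congruent; Injective)
open import Level using (Level; _⊔_)
open import Relation.Binary.Bundles using (Setoid)
import Relation.Binary.Construct.On as On
import Relation.Binary.Definitions as Binary
open import Relation.Binary.PropositionalEquality as ≡ using (_≡_; _≢_)
import Relation.Binary.Reasoning.Setoid as SetoidReasoning
open import Relation.Nullary.Decidable as Dec using (Dec; yes; no; ¬?; _×-dec_)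
open import Relation.Nullary.Negation using (¬_; contradiction)
open import Relation.Unary using (Decidable; Pred; _∩_; _⊆_)

open import Defs

private
  variable
    a b ℓ ℓ′ p p′ : Level

-- Divisibility of binomial coefficients by a prime.

prime∤! : ∀ {p} → Prime p → ∀ {k} → k < p → ¬ p ∣ k !
prime∤! pr {zero}  _   p∣1  = ¬prime[1] (≡.subst Prime (∣1⇒≡1 p∣1) pr)
prime∤! pr {suc k} k<p p∣k! with euclidsLemma (suc k) (k !) pr p∣k!
... | inj₁ p∣1+k = ℕ.<⇒≱ k<p (∣⇒≤ p∣1+k)
... | inj₂ p∣k!′ = prime∤! pr (ℕ.<-trans (ℕ.n<1+n k) k<p) p∣k!′

-- The prime divides `p !`, which is the product of `p C k` with two factorials; these are
-- factorials of numbers below `p`, so they contribute no factor `p`.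
prime∣C : ∀ {p} → Prime p → ∀ {k} → 0 < k → k < p → p ∣ p C k
prime∣C {p@(suc n)} pr {k} 0<k k<p
  with euclidsLemma (p C k) (k ! ℕ.* (p ∸ k) !) pr
         (≡.subst (p ∣_) (≡.sym C*k![p∸k]!≡p!) (m∣m*n (n !)))
  where
  instance _ = ℕ._!*_!≢0 k (p ∸ k)
  C*k![p∸k]!≡p! : (p C k) ℕ.* (k ! ℕ.* (p ∸ k) !) ≡ p !
  C*k![p∸k]!≡p! = ≡.trans
    (≡.cong (ℕ._* (k ! ℕ.* (p ∸ k) !)) (nCk≡n!/k![n-k]! (ℕ.<⇒≤ k<p)))
    (m/n*n≡m (k![n∸k]!∣n! (ℕ.<⇒≤ k<p)))
... | inj₁ p∣C = p∣C
... | inj₂ p∣k![p∸k]! with euclidsLemma (k !) ((p ∸ k) !) pr p∣k![p∸k]!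
...   | inj₁ p∣k!     = contradiction p∣k! (prime∤! pr k<p)
...   | inj₂ p∣[p∸k]! = contradiction p∣[p∸k]! (prime∤! pr (ℕ.∸-monoʳ-< 0<k (ℕ.<⇒≤ k<p)))

-- Lengths of filtered lists and of lists of pairwise combinations.

module _ {A : Set a} {P : Pred A p} (P? : Decidable P) where

  length-filter-∁ : ∀ xs → length xs ≡ length (filter P? xs) ℕ.+ length (filter (¬? ∘ P?) xs)
  length-filter-∁ [] = ≡.refl
  length-filter-∁ (x ∷ xs) with P? x
  ... | yes _ = ≡.cong suc (length-filter-∁ xs)
  ... | no  _ = ≡.trans (≡.cong suc (length-filter-∁ xs)) (≡.sym (ℕ.+-suc _ _))

length-cartesianProductWith : ∀ {c} {A : Set a} {B : Set b} {C : Set c} (f : A → B → C) xs ys →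
  length (cartesianProductWith f xs ys) ≡ length xs ℕ.* length ys
length-cartesianProductWith f []       ys = ≡.refl
length-cartesianProductWith f (x ∷ xs) ys = ≡.trans
  (length-++ (map (f x) ys))
  (≡.cong₂ ℕ._+_ (length-map (f x) ys) (length-cartesianProductWith f xs ys))

-- Counting subsets by duplicate-free lists.

module FiniteSubsets (X : Setoid a ℓ) where

  open Setoid X
  open Membership X using (_∈_)
  open Unique X using (Unique)

  -- Without duplicates a value has only one position. This makes `index` independent of the
  -- membership proof and an inverse of `lookup`, which is what a bijection with `Fin` requires.
  index-unique : ∀ {x xs} → Unique xs → ∀ i (x∈xs : x ∈ xs) → x ≈ lookup xs i → index x∈xs ≡ i
  index-unique (_ ∷ _)    Fin.zero    (here _)      _    = ≡.refl
  index-unique (y∉xs ∷ _) Fin.zero    (there x∈xs)  x≈y  =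
    contradiction (∈-resp-≈ X x≈y x∈xs) (All[≉]⇒∉ X y∉xs)
  index-unique (y∉xs ∷ _) (Fin.suc i) (here x≈y)    x≈xᵢ =
    contradiction (∈-resp-≈ X (trans (sym x≈xᵢ) x≈y) (∈-lookup X _ i)) (All[≉]⇒∉ X y∉xs)
  index-unique (_ ∷ xs!)  (Fin.suc i) (there x∈xs)  x≈xᵢ =
    ≡.cong Fin.suc (index-unique xs! i x∈xs x≈xᵢ)

  subset-cardinality : ∀ {S : Pred Carrier p} {xs} → Unique xs → All S xs →
    (∀ {x} → S x → x ∈ xs) → On.setoid X (proj₁ {B = S}) HasCardinality length xs
  subset-cardinality {xs = xs} xs! Sxs S⊆xs = record
    { to        = λ (_ , Sx) → index (S⊆xs Sx)
    ; cong      = λ {(_ , Sx)} {(_ , Sy)} x≈y →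
        index-unique xs! _ (S⊆xs Sx) (trans x≈y (Any.lookup-index (S⊆xs Sy)))
    ; bijective =
        (λ {(_ , Sx)} {(_ , Sy)} → index-injective X (S⊆xs Sx) (S⊆xs Sy)) ,
        (λ i → (lookup xs i , All.lookup Sxs (∈-lookup (≡.setoid _) xs i)) ,
               λ {(_ , Sz)} → index-unique xs! i (S⊆xs Sz))
    }

  -- An upper bound stated through duplicate-free lists of elements of `P`; it makes sense before
  -- `P` is known to be decidable or to have a cardinality.
  AtMost : ℕ → Pred Carrier p → Set (a ⊔ ℓ ⊔ p)
  AtMost n P = ∀ {xs} → Unique xs → All P xs → length xs ≤ n

  AtMost-preimage : ∀ {n} {P : Pred Carrier p} {Q : Pred Carrier p′} (f : Carrier → Carrier) →
    Injective _≈_ _≈_ f → P ⊆ Q ∘ f → AtMost n Q → AtMost n P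
  AtMost-preimage {n = n} f f-injective P⊆Q∘f Q≤n {xs} xs! Pxs =
    ≡.subst (_≤ n) (length-map f xs)
      (Q≤n (Uniqueₚ.map⁺ X X f-injective xs!) (All.map⁺ (All.map P⊆Q∘f Pxs)))

  -- The union bound. Splitting the list by `P i` leaves a part bounded by `n` and a remainder whose
  -- members must satisfy one of the later predicates.
  AtMost-Any : ∀ {i} {I : Set i} {n} {P : I → Pred Carrier p} → (∀ i → Decidable (P i)) →
    (∀ i → AtMost n (P i)) → ∀ is → AtMost (length is ℕ.* n) (λ x → Any (λ i → P i x) is)
  AtMost-Any P? P≤n [] {[]}    _ _        = z≤n
  AtMost-Any P? P≤n [] {_ ∷ _} _ (() ∷ _)
  AtMost-Any P? P≤n (i ∷ is) {xs} xs! Pxs = begin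
    length xs
      ≡⟨ length-filter-∁ (P? i) xs ⟩
    length (filter (P? i) xs) ℕ.+ length (filter (¬? ∘ P? i) xs)
      ≤⟨ ℕ.+-mono-≤
           (P≤n i (Uniqueₚ.filter⁺ X (P? i) xs!) (All.all-filter (P? i) xs))
           (AtMost-Any P? P≤n is (Uniqueₚ.filter⁺ X (¬? ∘ P? i) xs!)
             (All.zipWith (λ (¬Pᵢx , Px) → Any.tail ¬Pᵢx Px)
               (All.all-filter (¬? ∘ P? i) xs , All.filter⁺ (¬? ∘ P? i) Pxs))) ⟩
    _ ∎
    where open ℕ.≤-Reasoning

-- Finite setoids: decidable equality, exhaustive search and reindexing of sums.

module Finite (X : Setoid a ℓ) {n} (X-finite : X HasCardinality n) where

  open Setoid X
  open Membership X using (_∈_; lose)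
  open Unique X using (Unique)
  open FiniteSubsets X
  open Bijection X-finite using (to; cong; injective; surjective)

  infix 4 _≟_

  _≟_ : Binary.Decidable _≈_
  x ≟ y = Dec.map′ injective cong (to x Fin.≟ to y)

  element : Fin n → Carrier
  element i = proj₁ (surjective i)

  to-element : ∀ i → to (element i) ≡ i
  to-element i = proj₂ (surjective i) refl

  element-to : ∀ x → element (to x) ≈ x
  element-to x = injective (to-element (to x))

  elements : List Carrier
  elements = tabulate element

  elements-unique : Unique elements
  elements-unique = Uniqueₚ.tabulate⁺ X λ {i} {j} eᵢ≈eⱼ →
    ≡.trans (≡.sym (to-element i)) (≡.trans (cong eᵢ≈eⱼ) (to-element j))

  ∈-elements : ∀ x → x ∈ elements
  ∈-elements x = ∈-resp-≈ X (element-to x) (∈-tabulate⁺ X (to x))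

  any? : ∀ {P : Pred Carrier p} → P Binary.Respects _≈_ → Decidable P → Dec (∃ P)
  any? resp P? = Dec.map′ Any.satisfied (λ (x , Px) → lose resp (∈-elements x) Px) (Any.any? P? elements)

  decidable-subset-cardinality : ∀ {m} {S : Pred Carrier p} → S Binary.Respects _≈_ → Decidable S →
    AtMost m S → ∃ λ k → On.setoid X (proj₁ {B = S}) HasCardinality k × k ≤ m
  decidable-subset-cardinality resp S? S≤m = length xs , subset-cardinality xs! Sxs
    (λ Sx → ∈-filter⁺ X S? resp (∈-elements _) Sx) , S≤m xs! Sxs
    where
    xs  = filter S? elements
    xs! = Uniqueₚ.filter⁺ X S? elements-unique
    Sxs = All.all-filter S? elements

  module _ (M : CommutativeMonoid b ℓ′) where

    private module M = CommutativeMonoid M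
    open CommutativeMonoidSum M using (sum; sum-permute; sum-cong-≋)

    -- A map with a two-sided inverse permutes the setoid; transported along the bijection with
    -- `Fin n` it becomes a permutation of the summation indices. The monoid is arbitrary, so
    -- products are covered as well as sums.
    sum-invariant : (g : Carrier → M.Carrier) → Congruent _≈_ M._≈_ g →
      (φ ψ : Carrier → Carrier) → Congruent _≈_ _≈_ φ → Congruent _≈_ _≈_ ψ →
      (∀ x → φ (ψ x) ≈ x) → (∀ x → ψ (φ x) ≈ x) →
      sum (g ∘ element) M.≈ sum (g ∘ φ ∘ element)
    sum-invariant g g-cong φ ψ φ-cong ψ-cong φψ ψφ = M.trans
      (sum-permute (g ∘ element) π)
      (sum-cong-≋ (λ i → g-cong (element-to (φ (element i)))))
      where
      conjugate : ∀ α β → Congruent _≈_ _≈_ α → (∀ x → α (β x) ≈ x) →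
        ∀ i → to (α (element (to (β (element i))))) ≡ i
      conjugate α β α-cong αβ i = ≡.trans
        (cong (trans (α-cong (element-to _)) (αβ _))) (to-element i)

      π : Permutation′ n
      π = permutation (to ∘ φ ∘ element) (to ∘ ψ ∘ element)
        (conjugate φ ψ φ-cong φψ) (conjugate ψ φ ψ-cong ψφ)

-- Listing the members of a finite subset.

module FiniteSubset (X : Setoid a ℓ) {S : Pred (Setoid.Carrier X) p} {n}
                    (S-finite : On.setoid X (proj₁ {B = S}) HasCardinality n) where

  open Setoid X
  open Membership X using (_∈_)
  open Unique X using (Unique)

  private
    module S = Finite (On.setoid X (proj₁ {B = S})) S-finite

  members : List Carrier
  members = map proj₁ S.elements

  length-members : length members ≡ n
  length-members = ≡.trans (length-map proj₁ S.elements) (length-tabulate S.element)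

  members-unique : Unique members
  members-unique = Uniqueₚ.map⁺ (On.setoid X (proj₁ {B = S})) X (λ x≈y → x≈y) S.elements-unique

  members⊆ : All S members
  members⊆ = All.map⁺ (All.universal proj₂ S.elements)

  ∈-members : ∀ {x} → S x → x ∈ members
  ∈-members Sx = ∈-map⁺ (On.setoid X (proj₁ {B = S})) X {f = proj₁} (λ x≈y → x≈y) {_ , Sx}
    (S.∈-elements (_ , Sx))

  distinct-members : n ≥ 2 → ∃₂ λ x y → S x × S y × ¬ x ≈ y
  distinct-members n≥2 = pair members-unique members⊆ (≡.subst (_≥ 2) (≡.sym length-members) n≥2)
    where
    pair : ∀ {xs} → Unique xs → All S xs → length xs ≥ 2 → ∃₂ λ x y → S x × S y × ¬ x ≈ y
    pair {x ∷ y ∷ _} ((x≉y ∷ _) ∷ _) (Sx ∷ Sy ∷ _) _ = x , y , Sx , Sy , x≉y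
    pair {_ ∷ []}    _               _             (s≤s ())

-- Cancellation, roots of monic polynomials and the Frobenius map in a field.

module FieldProperties {c ℓ} (F : Field c ℓ) where

  open Field F
  open FiniteSubsets setoid
  open Exp semiring using (_^_; ^-congˡ; ^-assocʳ)
  open Mult semiring using (×-congˡ; ×-congʳ; ×1-homo-*; ×-assoc-*) renaming (_×_ to _×′_)
  open RingProperties ring using (x[y-z]≈xy-xz; [y-z]x≈yx-zx)
  open GroupProperties +-group using (x∙y⁻¹≈ε⇒x≈y; x≈y⇒x∙y⁻¹≈ε)
  open SemiringSolver commutativeSemiring using (solve; _:=_; _:+_; _:*_; con)
  open SetoidReasoning setoid

  x≉0∧xy≈0⇒y≈0 : ∀ {x y} → ¬ x ≈ 0# → x * y ≈ 0# → y ≈ 0#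
  x≉0∧xy≈0⇒y≈0 {x} {y} x≉0 xy≈0 = let x⁻¹ , x⁻¹x≈1 , _ = invertible x x≉0 in begin
    y              ≈⟨ *-identityˡ y ⟨
    1# * y         ≈⟨ *-congʳ x⁻¹x≈1 ⟨
    x⁻¹ * x * y    ≈⟨ *-assoc x⁻¹ x y ⟩
    x⁻¹ * (x * y)  ≈⟨ *-congˡ xy≈0 ⟩
    x⁻¹ * 0#       ≈⟨ zeroʳ x⁻¹ ⟩
    0#             ∎

  x≉0∧xy≈xz⇒y≈z : ∀ {x y z} → ¬ x ≈ 0# → x * y ≈ x * z → y ≈ z
  x≉0∧xy≈xz⇒y≈z {x} {y} {z} x≉0 xy≈xz = x∙y⁻¹≈ε⇒x≈y y z
    (x≉0∧xy≈0⇒y≈0 x≉0 (trans (x[y-z]≈xy-xz x y z) (x≈y⇒x∙y⁻¹≈ε xy≈xz)))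

  *-≉0 : ∀ {x y} → ¬ x ≈ 0# → ¬ y ≈ 0# → ¬ x * y ≈ 0#
  *-≉0 x≉0 y≉0 xy≈0 = y≉0 (x≉0∧xy≈0⇒y≈0 x≉0 xy≈0)

  ^-≉0 : ∀ {x} → ¬ x ≈ 0# → ∀ n → ¬ x ^ n ≈ 0#
  ^-≉0 x≉0 zero    = 1≉0
  ^-≉0 x≉0 (suc n) = *-≉0 x≉0 (^-≉0 x≉0 n)

  1^n≈1 : ∀ n → 1# ^ n ≈ 1#
  1^n≈1 zero    = refl
  1^n≈1 (suc n) = trans (*-identityˡ _) (1^n≈1 n)

  x≉y∧xz≈yz⇒z≈0 : ∀ {x y z} → ¬ x ≈ y → x * z ≈ y * z → z ≈ 0#
  x≉y∧xz≈yz⇒z≈0 {x} {y} {z} x≉y xz≈yz = x≉0∧xy≈0⇒y≈0 (x≉y ∘ x∙y⁻¹≈ε⇒x≈y x y)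
    (trans ([y-z]x≈yx-zx z x y) (x≈y⇒x∙y⁻¹≈ε xz≈yz))

  -- The vector lists the coefficients below the leading one, constant term
  -- first; the leading coefficient is 1, so the degree is the length.
  ⟦_⟧ : ∀ {n} → Vec Carrier n → Carrier → Carrier
  ⟦ []    ⟧ x = 1#
  ⟦ a ∷ p ⟧ x = ⟦ p ⟧ x * x + a

  -- Synthetic division by X - r: the coefficients of the quotient are the intermediate Horner
  -- values at `r`.
  quotient : ∀ {n} → Vec Carrier (suc n) → Carrier → Vec Carrier n
  quotient (a ∷ [])        r = []
  quotient (a ∷ p@(_ ∷ _)) r = ⟦ p ⟧ r ∷ quotient p r

  -- ⟦ p ⟧ x - ⟦ p ⟧ r = (x - r) ⟦ quotient p r ⟧ x, without subtraction.
  ⟦⟧-quotient : ∀ {n} (p : Vec Carrier (suc n)) r x →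
    ⟦ p ⟧ x + r * ⟦ quotient p r ⟧ x ≈ ⟦ p ⟧ r + x * ⟦ quotient p r ⟧ x
  ⟦⟧-quotient (a ∷ []) r x = solve 3
    (λ a r x → con 1 :* x :+ a :+ r :* con 1 := con 1 :* r :+ a :+ x :* con 1) refl a r x
  ⟦⟧-quotient (a ∷ p@(_ ∷ _)) r x = begin
    px * x + a + r * (qx * x + pr)
      ≈⟨ solve 6 (λ a r x px pr qx → px :* x :+ a :+ r :* (qx :* x :+ pr)
           := (px :+ r :* qx) :* x :+ (a :+ r :* pr)) refl a r x px pr qx ⟩
    (px + r * qx) * x + (a + r * pr)
      ≈⟨ +-congʳ (*-congʳ (⟦⟧-quotient p r x)) ⟩
    (pr + x * qx) * x + (a + r * pr)
      ≈⟨ solve 5 (λ a r x pr qx → (pr :+ x :* qx) :* x :+ (a :+ r :* pr)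
           := pr :* r :+ a :+ x :* (qx :* x :+ pr)) refl a r x pr qx ⟩
    pr * r + a + x * (qx * x + pr) ∎
    where
    px = ⟦ p ⟧ x
    pr = ⟦ p ⟧ r
    qx = ⟦ quotient p r ⟧ x

  -- Induction on the degree: once a root `r` is split off, every root different from `r` is a root
  -- of the quotient.
  roots≤degree : ∀ {n} (p : Vec Carrier n) → AtMost n (λ x → ⟦ p ⟧ x ≈ 0#)
  roots≤degree p  {[]} _ _ = z≤n
  roots≤degree [] {_ ∷ _} _ (1≈0 ∷ _) = contradiction 1≈0 1≉0
  roots≤degree p@(_ ∷ _) {r ∷ xs} (r≉xs ∷ xs!) (pr≈0 ∷ pxs≈0) =
    s≤s (roots≤degree (quotient p r) xs! (All.zipWith quotient-root (r≉xs , pxs≈0)))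
    where
    quotient-root : ∀ {x} → ¬ r ≈ x × ⟦ p ⟧ x ≈ 0# → ⟦ quotient p r ⟧ x ≈ 0#
    quotient-root {x} (r≉x , px≈0) = x≉y∧xz≈yz⇒z≈0 r≉x (begin
      r * qx             ≈⟨ +-identityˡ _ ⟨
      0# + r * qx        ≈⟨ +-congʳ px≈0 ⟨
      ⟦ p ⟧ x + r * qx   ≈⟨ ⟦⟧-quotient p r x ⟩
      ⟦ p ⟧ r + x * qx   ≈⟨ +-congʳ pr≈0 ⟩
      0# + x * qx        ≈⟨ +-identityˡ _ ⟩
      x * qx             ∎)
      where qx = ⟦ quotient p r ⟧ x

  ⟦replicate-0⟧ : ∀ n x → ⟦ Vec.replicate n 0# ⟧ x ≈ x ^ n
  ⟦replicate-0⟧ zero    x = refl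
  ⟦replicate-0⟧ (suc n) x =
    trans (+-identityʳ _) (trans (*-comm _ x) (*-congˡ (⟦replicate-0⟧ n x)))

  AtMost-kth-roots : ∀ k .{{_ : NonZero k}} y → AtMost k (λ x → y ≈ x ^ k)
  -- With the identity map, `AtMost-preimage` merely passes from the set of roots of a polynomial to
  -- a subset of it.
  AtMost-kth-roots (suc k) y = AtMost-preimage (λ x → x) (λ x≈y → x≈y)
    (λ {x} y≈x^k → trans (+-congʳ (trans (*-comm _ x) (*-congˡ (⟦replicate-0⟧ k x))))
                         (x≈y⇒x∙y⁻¹≈ε (sym y≈x^k)))
    -- The lower coefficients of the monic polynomial X^(k+1) - y.
    (roots≤degree (- y ∷ Vec.replicate k 0#))

  -- In the binomial expansion all terms except the two outer ones have a coefficient divisible by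
  -- `p`, and multiples of `p` vanish in the field.
  freshman : ∀ {p} → Prime p → p ×′ 1# ≈ 0# → ∀ x y → (x + y) ^ p ≈ x ^ p + y ^ p
  freshman {p@(suc n)} pr p≈0 x y = begin
    (x + y) ^ p
      ≈⟨ theorem p x y ⟩
    term Fin.zero + sum (term ∘ Fin.suc)
      ≈⟨ +-congˡ (sum-init-last (term ∘ Fin.suc)) ⟩
    term Fin.zero + (sum (term ∘ Fin.suc ∘ inject₁) + term (Fin.suc (fromℕ n)))
      ≈⟨ +-cong first (+-cong (trans (sum-cong-≋ middle) (sum-replicate-zero n)) last) ⟩
    y ^ p + (0# + x ^ p)
      ≈⟨ +-congˡ (+-identityˡ _) ⟩
    y ^ p + x ^ p
      ≈⟨ +-comm _ _ ⟩
    x ^ p + y ^ p ∎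
    where
    open Binomial commutativeSemiring using (theorem; binomialTerm)
    open CommutativeMonoidSum +-commutativeMonoid using (sum; sum-init-last; sum-cong-≋; sum-replicate-zero)

    term : Fin (suc p) → Carrier
    term = binomialTerm x y p

    multiple≈0 : ∀ {m} → p ∣ m → ∀ z → m ×′ z ≈ 0#
    multiple≈0 (divides q ≡.refl) z = begin
      (q ℕ.* p) ×′ z             ≈⟨ ×-congʳ (q ℕ.* p) (*-identityˡ z) ⟨
      (q ℕ.* p) ×′ (1# * z)      ≈⟨ ×-assoc-* (q ℕ.* p) 1# z ⟨
      (q ℕ.* p) ×′ 1# * z        ≈⟨ *-congʳ (×1-homo-* q p) ⟩
      (q ×′ 1#) * (p ×′ 1#) * z  ≈⟨ *-congʳ (*-congˡ p≈0) ⟩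
      (q ×′ 1#) * 0# * z         ≈⟨ *-congʳ (zeroʳ _) ⟩
      0# * z                     ≈⟨ zeroˡ z ⟩
      0#                         ∎

    first : term Fin.zero ≈ y ^ p
    first = begin
      (p C 0) ×′ (1# * y ^ p)  ≈⟨ ×-congˡ (≡.trans (nCk≡nC[n∸k] {k = 0} {n = p} z≤n) (nCn≡1 p)) ⟩
      1 ×′ (1# * y ^ p)        ≈⟨ +-identityʳ _ ⟩
      1# * y ^ p               ≈⟨ *-identityˡ _ ⟩
      y ^ p                    ∎

    last : term (Fin.suc (fromℕ n)) ≈ x ^ p
    last rewrite Fin.toℕ-fromℕ n | nCn≡1 p | ℕ.n∸n≡0 n = trans (+-identityʳ _) (*-identityʳ _)

    middle : ∀ i → term (Fin.suc (inject₁ i)) ≈ 0#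
    -- The exponent is one more than a number below `n`, hence strictly between 0 and `p = suc n`.
    middle i = multiple≈0 (prime∣C pr (s≤s z≤n)
      (s≤s (≡.subst (_< n) (≡.sym (Fin.toℕ-inject₁ i)) (Fin.toℕ<n i)))) _

  frobenius : ∀ {p} → Prime p → p ×′ 1# ≈ 0# → ∀ e x y →
    (x + y) ^ (p ℕ.^ e) ≈ x ^ (p ℕ.^ e) + y ^ (p ℕ.^ e)
  frobenius     pr p≈0 zero    x y = trans (*-identityʳ _) (sym (+-cong (*-identityʳ x) (*-identityʳ y)))
  frobenius {p} pr p≈0 (suc e) x y = begin
    (x + y) ^ (p ℕ.* p ℕ.^ e)                  ≈⟨ ^-assocʳ (x + y) p (p ℕ.^ e) ⟨
    ((x + y) ^ p) ^ (p ℕ.^ e)                  ≈⟨ ^-congˡ (p ℕ.^ e) (freshman pr p≈0 x y) ⟩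
    (x ^ p + y ^ p) ^ (p ℕ.^ e)                ≈⟨ frobenius pr p≈0 e (x ^ p) (y ^ p) ⟩
    (x ^ p) ^ (p ℕ.^ e) + (y ^ p) ^ (p ℕ.^ e)  ≈⟨ +-cong (^-assocʳ x p (p ℕ.^ e)) (^-assocʳ y p (p ℕ.^ e)) ⟩
    x ^ (p ℕ.* p ℕ.^ e) + y ^ (p ℕ.* p ℕ.^ e)  ∎

-- Finite fields with `n` nonzero elements: Fermat's theorem and the characteristic.

module FiniteField {c ℓ} (F : Field c ℓ) {n} (F-finite : Field.setoid F HasCardinality suc n) where

  open Field F
  open Subsets F
  open FieldProperties F
  open FiniteSubsets setoid
  open Finite setoid F-finite
  open Exp semiring using (_^_; ^-congˡ; ^-congʳ; ^-homo-*; ^-assocʳ)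
  open Mult semiring using (×-congˡ; ×1-homo-*) renaming (_×_ to _×′_)
  open GroupProperties +-group using
    (identityʳ-unique; x∙y⁻¹≈ε⇒x≈y; //-rightDividesˡ; //-rightDividesʳ; ∙-cancelʳ)
  open SemiringSolver commutativeSemiring using (solve; _:=_; _:+_; _:*_; con)
  open SetoidReasoning setoid
  open Membership setoid using () renaming (_∈_ to _∈ₗ_)

  Nonzero : Pred Carrier ℓ
  Nonzero x = ¬ x ≈ 0#

  -- Deleting the index of `0#` from `Fin (suc n)` and closing the gap numbers the nonzero elements.
  Nonzero-finite : subsetoid Nonzero HasCardinality n
  Nonzero-finite = record
    { to        = λ (x , x≉0) → punchOut (0≢to x≉0)
    ; cong      = λ x≈y → Fin.punchOut-cong (to 0#) (cong x≈y)
    ; bijective = (λ {(_ , x≉0)} {(_ , y≉0)} eq →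
                    injective (Fin.punchOut-injective (0≢to x≉0) (0≢to y≉0) eq))
                , (λ j → (element (punchIn (to 0#) j) , elementⱼ≉0 j) , λ z≈ →
                    ≡.trans (Fin.punchOut-cong (to 0#) (≡.trans (cong z≈) (to-element _)))
                            (Fin.punchOut-punchIn (to 0#)))
    }
    where
    open Bijection F-finite using (to; cong; injective)

    0≢to : ∀ {x} → Nonzero x → to 0# ≢ to x
    0≢to x≉0 eq = x≉0 (injective (≡.sym eq))

    elementⱼ≉0 : ∀ j → Nonzero (element (punchIn (to 0#) j))
    elementⱼ≉0 j eq = Fin.punchInᵢ≢i (to 0#) j (≡.trans (≡.sym (to-element _)) (cong eq))

  -- Multiplication by `z` permutes the nonzero elements, so their product `Πx` equals `z ^ n * Πx`,
  -- and `Πx` can be cancelled.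
  fermat : ∀ {z} → Nonzero z → z ^ n ≈ 1#
  fermat {z} z≉0 with invertible z z≉0
  ... | z⁻¹ , z⁻¹z≈1 , zz⁻¹≈1 = sym (x≉0∧xy≈xz⇒y≈z Πx≉0 (begin
      Πx * 1#              ≈⟨ *-identityʳ Πx ⟩
      Πx                   ≈⟨ F*.sum-invariant *-commutativeMonoid proj₁ (λ x≈y → x≈y)
                                (scale z≉0) (scale z⁻¹≉0) *-congˡ *-congˡ
                                (λ _ → cancel zz⁻¹≈1) (λ _ → cancel z⁻¹z≈1) ⟩
      Π (λ i → z * x i)    ≈⟨ ∑-distrib-+ (λ _ → z) x ⟩
      Π {n} (λ _ → z) * Πx ≈⟨ *-congʳ (sum-replicate n) ⟩
      z ^ n * Πx           ≈⟨ *-comm _ _ ⟩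
      Πx * z ^ n           ∎))
    where
    open CommutativeMonoidSum *-commutativeMonoid using (∑-distrib-+; sum-replicate) renaming (sum to Π)
    module F* = Finite (subsetoid Nonzero) Nonzero-finite

    x : Fin n → Carrier
    x = proj₁ ∘ F*.element

    Πx : Carrier
    Πx = Π x

    Π≉0 : ∀ {m} (y : Fin m → Carrier) → (∀ i → Nonzero (y i)) → Nonzero (Π y)
    Π≉0 {zero}  y y≉0 = 1≉0
    Π≉0 {suc m} y y≉0 = *-≉0 (y≉0 Fin.zero) (Π≉0 (y ∘ Fin.suc) (y≉0 ∘ Fin.suc))

    Πx≉0 : Nonzero Πx
    Πx≉0 = Π≉0 x (proj₂ ∘ F*.element)

    scale : ∀ {u} → Nonzero u → ∃ Nonzero → ∃ Nonzero
    scale {u} u≉0 (y , y≉0) = u * y , *-≉0 u≉0 y≉0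

    z⁻¹≉0 : Nonzero z⁻¹
    z⁻¹≉0 z⁻¹≈0 = 1≉0 (trans (sym z⁻¹z≈1) (trans (*-congʳ z⁻¹≈0) (zeroˡ z)))

    cancel : ∀ {u v y} → u * v ≈ 1# → u * (v * y) ≈ y
    cancel uv≈1 = trans (sym (*-assoc _ _ _)) (trans (*-congʳ uv≈1) (*-identityˡ _))

  -- The additive analogue of `fermat`: translation by `1#` permutes the field, so the sum of all
  -- elements absorbs `suc n` copies of `1#`.
  order×1≈0 : suc n ×′ 1# ≈ 0#
  order×1≈0 = identityʳ-unique (sum element) _ (sym (begin
    sum element                          ≈⟨ sum-invariant +-commutativeMonoid (λ x → x) (λ x≈y → x≈y)
                                              (_+ 1#) (_- 1#) +-congʳ +-congʳ
                                              (//-rightDividesˡ 1#) (//-rightDividesʳ 1#) ⟩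
    sum (λ i → element i + 1#)           ≈⟨ ∑-distrib-+ element (λ _ → 1#) ⟩
    sum element + sum {suc n} (λ _ → 1#) ≈⟨ +-congˡ (sum-replicate (suc n)) ⟩
    sum element + suc n ×′ 1#            ∎))
    where open CommutativeMonoidSum +-commutativeMonoid using (sum; ∑-distrib-+; sum-replicate)

  -- The element `(p ^ f) ×′ 1#` is the `f`-th power of `p ×′ 1#`, and a field has no zero divisors.
  p×1≈0 : ∀ p f → suc n ≡ p ℕ.^ f → p ×′ 1# ≈ 0#
  p×1≈0 p f q≡p^f with p ×′ 1# ≟ 0#
  ... | yes p≈0 = p≈0
  ... | no  p≉0 = contradiction (trans (×-congˡ (≡.sym q≡p^f)) order×1≈0) (p^f≉0 f)
    where
    p^f≉0 : ∀ f → Nonzero ((p ℕ.^ f) ×′ 1#)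
    p^f≉0 zero    = 1≉0 ∘ trans (sym (+-identityʳ 1#))
    p^f≉0 (suc f) = *-≉0 p≉0 (p^f≉0 f) ∘ trans (sym (×1-homo-* p (p ℕ.^ f)))

  -- The group of `k`-th powers: decidability, size and exponent.

  Powers-resp : ∀ k → Powers k Binary.Respects _≈_
  Powers-resp k y≈y′ (x , x≉0 , y≈x^k) = x , x≉0 , trans (sym y≈y′) y≈x^k

  Powers? : ∀ k → Decidable (Powers k)
  Powers? k y = any? (λ x≈x′ (x≉0 , y≈x^k) → x≉0 ∘ trans x≈x′ , trans y≈x^k (^-congˡ k x≈x′))
                     (λ x → ¬? (x ≟ 0#) ×-dec y ≟ x ^ k)

  module _ (k : ℕ) .{{_ : NonZero k}} (k∣n : k ∣ n) where

    -- This is the lower bound |A| ≥ t: the `n` nonzero elements are distributed over fibres of the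
    -- `k`-th power map, each of size at most `k`. The list `ys` may contain repetitions, so a list
    -- of all sums `s + u` can be used as it is.
    Powers-cover : ∀ ys → (∀ {y} → Powers k y → y ∈ₗ ys) → n / k ≤ length ys
    Powers-cover ys Powers⊆ys = ℕ.*-cancelʳ-≤ (n / k) (length ys) k
      (≡.subst (_≤ length ys ℕ.* k) (≡.trans length-members (≡.sym (m/n*n≡m k∣n)))
        (AtMost-Any (λ y x → y ≟ x ^ k) (AtMost-kth-roots k) ys members-unique
          (All.map (λ x≉0 → Any.map sym (Powers⊆ys (_ , x≉0 , refl))) members⊆)))
      where open FiniteSubset setoid Nonzero-finite

    Powers-torsion : ∀ {m} → n / k ∣ m → ∀ {y} → Powers k y → y ^ m ≈ 1#
    Powers-torsion {m} (divides s m≡st) {y} (x , x≉0 , y≈x^k) = begin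
      y ^ m                            ≈⟨ ^-congˡ m y≈x^k ⟩
      (x ^ k) ^ m                      ≈⟨ ^-assocʳ x k m ⟩
      x ^ (k ℕ.* m)                    ≈⟨ ^-congʳ x km≡ns ⟩
      x ^ (n ℕ.* s)                    ≈⟨ ^-assocʳ x n s ⟨
      (x ^ n) ^ s                      ≈⟨ ^-congˡ s (fermat x≉0) ⟩
      1# ^ s                           ≈⟨ 1^n≈1 s ⟩
      1#                               ∎
      where
      km≡ns : k ℕ.* m ≡ n ℕ.* s
      km≡ns = ≡.trans (≡.cong (k ℕ.*_) m≡st) (≡.trans (≡.cong (k ℕ.*_) (ℕ.*-comm s (n / k)))
        (≡.trans (≡.sym (ℕ.*-assoc k (n / k) s))
          (≡.cong (ℕ._* s) (≡.trans (ℕ.*-comm k (n / k)) (m/n*n≡m k∣n)))))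

    -- Intersections of two shifts of the `k`-th powers, and irreducibility.

    module _ {p} (pr : Prime p) (p≈0 : p ×′ 1# ≈ 0#) {e} (t∣p^e+1 : n / k ∣ p ℕ.^ e ℕ.+ 1) where

      N : ℕ
      N = p ℕ.^ e

      Powers-inverse : ∀ {y} → Powers k y → y * y ^ N ≈ 1#
      Powers-inverse {y} Ay = begin
        y * y ^ N       ≈⟨ *-comm _ _ ⟩
        y ^ N * y       ≈⟨ *-congˡ (*-identityʳ y) ⟨
        y ^ N * y ^ 1   ≈⟨ ^-homo-* y N 1 ⟨
        y ^ (N ℕ.+ 1)   ≈⟨ Powers-torsion t∣p^e+1 Ay ⟩
        1#              ∎

      -- Here `w` stands for the inverse of `d ^ N`. Subtracting `v * V ≈ 1#` from the expanded
      -- product `(v + d) * (V + D) ≈ 1#` gives `v * D + d * V + d * D ≈ 0#`; multiplying by `w * v`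
      -- and simplifying eliminates `V` and `D`.
      difference-quadratic : ∀ {v d w} → w * d ^ N ≈ 1# → Powers k v → Powers k (v + d) →
        ⟦ d * w ∷ d ∷ [] ⟧ v ≈ 0#
      difference-quadratic {v} {d} {w} wD≈1 Av Av+d = begin
        (1# * v + d) * v + d * w
          ≈⟨ solve 3 (λ v d w → (con 1 :* v :+ d) :* v :+ d :* w
               := con 1 :* v :* v :+ con 1 :* d :* v :+ d :* w :* con 1) refl v d w ⟩
        1# * v * v + 1# * d * v + d * w * 1#
          -- Read from right to left: two of the units become `w * D` and the third `v * V`, after
          -- which `w * v` is a common factor.
          ≈⟨ +-cong (+-cong (*-congʳ (*-congʳ wD≈1)) (*-congʳ (*-congʳ wD≈1))) (*-congˡ (Powers-inverse Av)) ⟨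
        w * D * v * v + w * D * d * v + d * w * (v * V)
          ≈⟨ solve 5 (λ v d w D V → w :* D :* v :* v :+ w :* D :* d :* v :+ d :* w :* (v :* V)
               := w :* v :* (v :* D :+ d :* V :+ d :* D)) refl v d w D V ⟩
        w * v * (v * D + d * V + d * D)
          ≈⟨ *-congˡ (identityʳ-unique 1# _ expansion) ⟩
        w * v * 0#
          ≈⟨ zeroʳ _ ⟩
        0# ∎
        where
        D = d ^ N
        V = v ^ N
        expansion : 1# + (v * D + d * V + d * D) ≈ 1#
        expansion = begin
          1# + (v * D + d * V + d * D)      ≈⟨ +-congʳ (Powers-inverse Av) ⟨
          v * V + (v * D + d * V + d * D)   ≈⟨ solve 4 (λ v V d D → v :* V :+ (v :* D :+ d :* V :+ d :* D)
                                                 := (v :+ d) :* (V :+ D)) refl v V d D ⟩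
          (v + d) * (V + D)                 ≈⟨ *-congˡ (frobenius pr p≈0 e v d) ⟨
          (v + d) * (v + d) ^ N             ≈⟨ Powers-inverse Av+d ⟩
          1#                                ∎

      -- With `v = y + b` and `d = a - b`, both `v` and `v + d` are `k`-th powers, so `v` is a root
      -- of a quadratic depending only on `a` and `b`.
      AtMost-2-shifts : ∀ {a b} → ¬ a ≈ b → AtMost 2 (λ y → Powers k (y + a) × Powers k (y + b))
      AtMost-2-shifts {a} {b} a≉b = AtMost-preimage (_+ b) (∙-cancelʳ b _ _)
        (λ (Ay+a , Ay+b) → difference-quadratic w*d^N≈1 Ay+b (Powers-resp k y+a≈y+b+d Ay+a))
        (roots≤degree (d * w ∷ d ∷ []))
        where
        d = a - b
        d≉0 : Nonzero d
        d≉0 = a≉b ∘ x∙y⁻¹≈ε⇒x≈y a b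
        d^N-invertible = invertible (d ^ N) (^-≉0 d≉0 N)
        w = proj₁ d^N-invertible
        w*d^N≈1 = proj₁ (proj₂ d^N-invertible)
        y+a≈y+b+d : ∀ {y} → y + a ≈ y + b + d
        y+a≈y+b+d {y} = begin
          y + a          ≈⟨ +-congˡ (//-rightDividesˡ b a) ⟨
          y + (d + b)    ≈⟨ +-congˡ (+-comm d b) ⟩
          y + (b + d)    ≈⟨ +-assoc y b d ⟨
          y + b + d      ∎

      -- Membership of `y` in `Powers k ⊖ a` amounts to `y + a` being a `k`-th power, which is
      -- decidable; this turns the bound on lists into an actual cardinality.
      ∣shift∩shift∣≤2 : ∀ a b → ¬ a ≈ b → ∣ (Powers k ⊖ a) ∩ (Powers k ⊖ b) ∣≤ 2
      ∣shift∩shift∣≤2 a b a≉b = decidable-subset-cardinality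
        (λ x≈y (x∈A-a , x∈A-b) → ⊖-resp x≈y x∈A-a , ⊖-resp x≈y x∈A-b)
        (λ y → ⊖? a y ×-dec ⊖? b y)
        (AtMost-preimage (λ x → x) (λ x≈y → x≈y) (λ (y∈A-a , y∈A-b) → ⊖⇒+ y∈A-a , ⊖⇒+ y∈A-b)
          (AtMost-2-shifts a≉b))
        where
        ⊖-resp : ∀ {a x y} → x ≈ y → (Powers k ⊖ a) x → (Powers k ⊖ a) y
        ⊖-resp x≈y (z , Az , x≈z-a) = z , Az , trans (sym x≈y) x≈z-a
        ⊖⇒+ : ∀ {a y} → (Powers k ⊖ a) y → Powers k (y + a)
        ⊖⇒+ {a} (z , Az , y≈z-a) =
          Powers-resp k (sym (trans (+-congʳ y≈z-a) (//-rightDividesˡ a z))) Az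
        ⊖? : ∀ a → Decidable (Powers k ⊖ a)
        ⊖? a y = Dec.map′ (λ Ay+a → y + a , Ay+a , sym (//-rightDividesʳ a y)) ⊖⇒+ (Powers? k (y + a))

      irreducible : n / k > 4 → AdditivelyIrreducible (Powers k)
      irreducible t>4 (S , T , (m , S-finite , m≥2) , (m′ , T-finite , m′≥2) , A⊆S+T , S+T⊆A) =
        ℕ.<⇒≱ t>4 (ℕ.≤-trans (Powers-cover (cartesianProductWith _+_ ss ts) cover)
          (≡.subst (_≤ 4) (≡.sym (length-cartesianProductWith _+_ ss ts)) (ℕ.*-mono-≤ ∣S∣≤2 ∣T∣≤2)))
        where
        module S = FiniteSubset setoid S-finite
        module T = FiniteSubset setoid T-finite

        ss ts : List Carrier
        ss = S.members
        ts = T.members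

        ∣S∣≤2 : length ss ≤ 2
        ∣S∣≤2 = let t₁ , t₂ , Tt₁ , Tt₂ , t₁≉t₂ = T.distinct-members m′≥2 in
          -- Each element of `S` stays in `Powers k` when either of the two distinct elements `t₁`,
          -- `t₂` is added.
          AtMost-2-shifts t₁≉t₂ S.members-unique
            (All.map (λ Ss → S+T⊆A (_ , t₁ , Ss , Tt₁ , refl) , S+T⊆A (_ , t₂ , Ss , Tt₂ , refl))
                     S.members⊆)

        ∣T∣≤2 : length ts ≤ 2
        ∣T∣≤2 = let s₁ , s₂ , Ss₁ , Ss₂ , s₁≉s₂ = S.distinct-members m≥2 in
          AtMost-2-shifts s₁≉s₂ T.members-unique
            (All.map (λ Tt → S+T⊆A (s₁ , _ , Ss₁ , Tt , +-comm _ _) ,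
                             S+T⊆A (s₂ , _ , Ss₂ , Tt , +-comm _ _))
                     T.members⊆)

        cover : ∀ {y} → Powers k y → y ∈ₗ cartesianProductWith _+_ ss ts
        cover Ay = let s , t , Ss , Tt , y≈s+t = A⊆S+T Ay in
          ∈-resp-≈ setoid (sym y≈s+t)
            (∈-cartesianProductWith⁺ setoid setoid setoid +-cong (S.∈-members Ss) (T.∈-members Tt))

-- Specialisation to fields of order `p ^ f`.

open import Data.Nat.Base using (_^_; _+_)

corollary1p6 : ∀ {c ℓ} (p f q : ℕ) → Prime p → f ≥ 1 → q ≡ p ^ f →
    (F : Field c ℓ) → Field.setoid F HasCardinality q →
    (k : ℕ) .{{_ : NonZero k}} → k ∣ q ∸ 1 →
    let open Field F using (Carrier)
        open Field F using (_≈_)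
        open Subsets F
        t = (q ∸ 1) / k
    in t > 4 →
    (∃ λ e → e ≥ 1 × t ∣ p ^ e + 1) →
    (∀ (a b : Carrier) → ¬ (a ≈ b) → ∣ (Powers k ⊖ a) ∩ (Powers k ⊖ b) ∣≤ 2)
    × AdditivelyIrreducible (Powers k)
-- The element `0#` would have an image in the empty `Fin 0`. In the other clause `q ∸ 1` reduces to
-- `n`.
corollary1p6 p f zero    _  _ _     F F-finite with () ← Bijection.to F-finite (Field.0# F)
corollary1p6 p f (suc n) pr _ q≡p^f F F-finite k k∣n t>4 (e , _ , t∣p^e+1) =
  ∣shift∩shift∣≤2 k k∣n pr p≈0 {e} t∣p^e+1 , irreducible k k∣n pr p≈0 {e} t∣p^e+1 t>4
  where
  open FiniteField F F-finite
  p≈0 = p×1≈0 p f q≡p^f
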